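{- Let $G$ be a critical graph with $m$ edges. Then for all integers $t \geq 3m$, the graph $G \vee K_t$ is strongly critical.
   Context: All graphs are finite and simple. For an integer $k \geq 1$, a graph $G$ is $k$-critical if $\chi(G) = k$ and $\chi(G') < k$ for every proper subgraph $G'$ of $G$; $G$ is critical if it is $k$-critical for some $k \geq 1$. The join $G \vee H$ of graphs $G$ and $H$ is obtained from vertex-disjoint copies of $G$ and $H$ by making every vertex of $G$ adjacent to every vertex of $H$. $K_t$ is the complete graph on $t$ vertices. A list assignment $L$ for $G$ assigns a set $L(v)$ of colors to each $v \in V(G)$; it is a $q$-assignment if $|L(v)| = q$ for all $v$. A proper $L$-coloring is a choice of $f(v) \in L(v)$ for every $v \in V(G)$ such that adjacent vertices receive different colors. $G$ is $L$-colorable if a proper $L$-coloring exists; otherwise $L$ is bad for $G$. A $q$-assignment is constant if it assigns the same $q$-element set to every vertex. For $k \geq 1$, a graph $G$ is strongly $k$-critical if $G$ is $k$-critical and every bad $(k-1)$-assignment for $G$ is constant. $G$ is strongly critical if it is strongly $k$-critical for some $k \geq 1$. -}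

module Defs where

open import Level using (0ℓ)
open import Data.Nat.Base using (ℕ; _+_; _∸_; _≤_; _<_)
open import Data.Fin.Base using (Fin; splitAt) renaming (_<_ to _<ᶠ_)
open import Data.Fin.Properties using (_≟_) renaming (_<?_ to _<ᶠ?_)
open import Data.Fin.Subset using (Subset; _∈_; ∣_∣)
open import Data.List.Base using (List; allFin; cartesianProduct; filter; length)
open import Data.Product.Base using (_×_; _,_; ∃-syntax; proj₁; proj₂)
open import Data.Sum.Base using (_⊎_; inj₁; inj₂)
open import Data.Unit.Base using (⊤; tt)
open import Function.Definitions using (Injective)
open import Relation.Binary.Core using (Rel)
open import Relation.Binary.Definitions using (Symmetric; Decidable)
open import Relation.Binary.PropositionalEquality using (_≡_; _≢_; refl; ≢-sym)
open import Relation.Nullary using (¬_; yes; ¬?; _×-dec_)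

record Graph (n : ℕ) : Set₁ where
  field
    Adj    : Rel (Fin n) 0ℓ
    adj?   : Decidable Adj
    sym    : Symmetric Adj
    irrefl : ∀ v → ¬ Adj v v

open Graph public

-- Each edge is listed once, as the pair (u , v) with u < v.
edges : ∀ {n} → Graph n → List (Fin n × Fin n)
edges {n} G =
  filter (λ e → (proj₁ e <ᶠ? proj₂ e) ×-dec adj? G (proj₁ e) (proj₂ e))
         (cartesianProduct (allFin n) (allFin n))

numEdges : ∀ {n} → Graph n → ℕ
numEdges G = length (edges G)

K : ∀ t → Graph t
K t = record
  { Adj    = _≢_
  ; adj?   = λ u v → ¬? (u ≟ v)
  ; sym    = ≢-sym
  ; irrefl = λ v v≢v → v≢v refl
  }

module _ {m n : ℕ} (G : Graph m) (H : Graph n) where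

  JoinAdj : Rel (Fin m ⊎ Fin n) 0ℓ
  JoinAdj (inj₁ u) (inj₁ v) = Adj G u v
  JoinAdj (inj₁ _) (inj₂ _) = ⊤
  JoinAdj (inj₂ _) (inj₁ _) = ⊤
  JoinAdj (inj₂ u) (inj₂ v) = Adj H u v

  joinAdj? : Decidable JoinAdj
  joinAdj? (inj₁ u) (inj₁ v) = adj? G u v
  joinAdj? (inj₁ _) (inj₂ _) = yes tt
  joinAdj? (inj₂ _) (inj₁ _) = yes tt
  joinAdj? (inj₂ u) (inj₂ v) = adj? H u v

  joinSym : Symmetric JoinAdj
  joinSym {inj₁ _} {inj₁ _} = sym G
  joinSym {inj₁ _} {inj₂ _} = λ _ → tt
  joinSym {inj₂ _} {inj₁ _} = λ _ → tt
  joinSym {inj₂ _} {inj₂ _} = sym H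

  joinIrrefl : ∀ x → ¬ JoinAdj x x
  joinIrrefl (inj₁ u) = irrefl G u
  joinIrrefl (inj₂ v) = irrefl H v

-- splitAt m identifies Fin (m + n) with the disjoint union Fin m ⊎ Fin n.
infixr 6 _∨_
_∨_ : ∀ {m n} → Graph m → Graph n → Graph (m + n)
_∨_ {m} G H = record
  { Adj    = λ u v → JoinAdj G H (splitAt m u) (splitAt m v)
  ; adj?   = λ u v → joinAdj? G H (splitAt m u) (splitAt m v)
  ; sym    = λ {u} {v} → joinSym G H {splitAt m u} {splitAt m v}
  ; irrefl = λ v → joinIrrefl G H (splitAt m v)
  }

-- A subgraph of G is given by a graph G′ on its own vertex set Fin n′ together
-- with an inclusion, i.e. an injective, edge-preserving map into G.
record _⊑_ {n′ n : ℕ} (G′ : Graph n′) (G : Graph n) : Set where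
  field
    ι           : Fin n′ → Fin n
    ι-injective : Injective _≡_ _≡_ ι
    ι-edge      : ∀ {u v} → Adj G′ u v → Adj G (ι u) (ι v)

open _⊑_ public

-- A subgraph is proper if it omits a vertex of G, or omits an edge of G both
-- of whose ends it contains.
Proper : ∀ {n′ n} {G′ : Graph n′} {G : Graph n} → G′ ⊑ G → Set
Proper {G′ = G′} {G} s =
    (∃[ v ] ∀ u → ι s u ≢ v)
  ⊎ (∃[ u ] ∃[ v ] Adj G (ι s u) (ι s v) × ¬ Adj G′ u v)

IsProperColoring : ∀ {n} {C : Set} → Graph n → (Fin n → C) → Set
IsProperColoring G f = ∀ {u v} → Adj G u v → f u ≢ f v

Colorable : ∀ {n} → Graph n → ℕ → Set
Colorable {n} G k = ∃[ f ] IsProperColoring {n} {Fin k} G f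

χ[_]≡_ : ∀ {n} → Graph n → ℕ → Set
χ[ G ]≡ k = Colorable G k × (∀ j → Colorable G j → k ≤ j)

-- The numerical inequality χ(G) < k, with χ(G) given as a relation.
χ[_]<_ : ∀ {n} → Graph n → ℕ → Set
χ[ G ]< k = ∃[ j ] (χ[ G ]≡ j) × j < k

IsCritical : ∀ {n} → ℕ → Graph n → Set₁
IsCritical k G =
    1 ≤ k
  × (χ[ G ]≡ k)
  × (∀ {n′} (G′ : Graph n′) (s : G′ ⊑ G) → Proper s → χ[ G′ ]< k)

Critical : ∀ {n} → Graph n → Set₁
Critical G = ∃[ k ] IsCritical k G

-- Colors are taken from a palette Fin c; since c is arbitrary and only finitely
-- many colors occur in the lists of a finite graph, this is no restriction as
-- long as statements quantify over all c.
ListAssignment : ℕ → ℕ → Set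
ListAssignment n c = Fin n → Subset c

IsAssignment : ∀ {n c} → ℕ → ListAssignment n c → Set
IsAssignment q L = ∀ v → ∣ L v ∣ ≡ q

IsConstant : ∀ {n c} → ListAssignment n c → Set
IsConstant L = ∃[ S ] ∀ v → L v ≡ S

ListColorable : ∀ {n c} → Graph n → ListAssignment n c → Set
ListColorable G L = ∃[ f ] (∀ v → f v ∈ L v) × IsProperColoring G f

Bad : ∀ {n c} → Graph n → ListAssignment n c → Set
Bad G L = ¬ ListColorable G L

IsStronglyCritical : ∀ {n} → ℕ → Graph n → Set₁
IsStronglyCritical {n} k G =
    IsCritical k G
  × (∀ {c} (L : ListAssignment n c) →
       IsAssignment (k ∸ 1) L → Bad G L → IsConstant L)

StronglyCritical : ∀ {n} → Graph n → Set₁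
StronglyCritical G = ∃[ k ] IsStronglyCritical k G

{-# OPTIONS --safe #-}

-- Let G be (q+1)-critical and let L be a (q+t)-assignment of G ∨ K_t whose lists are not all equal; we colour.
-- With s clique vertices left, call v ∈ G happy if |L v| > s + deg v: such a vertex can always be coloured last.
-- Let need v = max(0, s + deg v + 1 - |L v|), so that v is happy iff need v = 0.
-- If a clique vertex has a colour x missing from the list of an unhappy w, give it x and delete x from all other
-- lists: lists keep size ≥ q + s, and Σ need drops, as does s.  Initially Σ need ≤ Σ deg = 2m ≤ t (if q = 0, then G
-- is a single vertex with need 1), so Σ need ≤ s persists, and when s = 0 everything is happy.
-- If the process is stuck, the list of some clique vertex lies in the list of every unhappy vertex.
-- Pick v that is happy or has |L v| > q + s, colour the unhappy vertices of the q-colourable graph G - v with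
-- q colours of that list, give v, if unhappy, a further colour, then colour the clique and the happy vertices greedily.
-- The first step needs lists of some a ∈ K_t and v ∈ G to differ; from then on such a vertex v exists.
module Submission where

import Algebra.Properties.CommutativeMonoid.Sum
open import Data.Bool.Base using (true; false; if_then_else_)
open import Data.Fin.Base
  using (Fin; zero; suc; toℕ; punchIn; punchOut; _↑ˡ_; _↑ʳ_; splitAt; join; inject≤; finToFun; funToFin)
  renaming (_<_ to _<ᶠ_)
open import Data.Fin.Properties
  using (_≟_; any?; all?; suc-injective; toℕ<n; punchInᵢ≢i; punchIn-injective; punchIn-punchOut; punchOut-injective;
         inject≤-injective; finToFun-funToFin; splitAt-join; join-splitAt; <-cmp)
  renaming (_<?_ to _<ᶠ?_)
open import Data.Fin.Subset using (Subset; _∈_; _∉_; _⊆_; ∣_∣; ⊥; inside; outside; Nonempty)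
open import Data.Fin.Subset.Properties
  using (_∈?_; nonempty?; Empty-unique; ∣⊥∣≡0; p⊆q⇒∣p∣≤∣q∣; p⊂q⇒∣p∣<∣q∣; ⊆-antisym; ⊆-min)
open import Data.List.Base using (List; []; _∷_; _++_; length; map; filter; tabulate; allFin; cartesianProduct)
open import Data.List.Membership.Propositional using () renaming (_∈_ to _∈ˡ_; _∉_ to _∉ˡ_)
open import Data.List.Membership.Propositional.Properties
  using (∈-map⁺; ∈-++⁺ˡ; ∈-++⁺ʳ; ∈-tabulate⁺; ∈-filter⁺; ∈-allFin; ∈-length)
open import Data.List.Properties using (length-++; length-map; length-tabulate; filter-++; map-tabulate)
open import Data.List.Relation.Unary.All using (All; []; _∷_)
open import Data.List.Relation.Unary.All.Properties using (all-filter)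
open import Data.List.Relation.Unary.Any using (here; there)
open import Data.Nat.Base using (ℕ; zero; suc; _+_; _*_; _∸_; _^_; _≤_; _<_; z≤n; s≤s)
open import Data.Nat.Properties
  using (≤-refl; ≤-trans; ≤-reflexive; ≤-pred; <-≤-trans; ≤-<-trans; ≮⇒≥; ≰⇒>; <⇒≢; <⇒≱; n≮0; n≤0⇒n≡0;
         m≤m+n; m≤n+m; +-suc; +-comm; +-identityʳ; +-mono-≤; +-mono-<-≤; +-mono-≤-<; +-monoʳ-≤; +-monoˡ-≤;
         +-cancelˡ-≤; ∸-monoʳ-≤; +-∸-assoc; m+n∸m≡n; m∸n≡0⇒m≤n;
         _<?_; +-0-commutativeMonoid; module ≤-Reasoning)
open import Data.Product.Base using (_×_; _,_; ∃; ∃-syntax; Σ-syntax; proj₁; proj₂)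
open import Data.Sum.Base using (_⊎_; inj₁; inj₂; fromInj₂; swap)
open import Data.Sum.Properties using (inj₁-injective; inj₂-injective)
open import Data.Unit.Base using (tt)
open import Data.Vec.Base using (_[_]≔_; here; there) renaming (_∷_ to _∷ᵛ_)
open import Data.Vec.Functional using (updateAt; insertAt)
open import Data.Vec.Functional.Properties
  using (updateAt-updates; updateAt-minimal; insertAt-lookup; insertAt-punchIn)
open import Data.Vec.Properties using ([]≔-minimal)
open import Function.Base using (_∘_; const)
open import Function.Definitions using (Injective)
open import Relation.Binary.Definitions using (Tri; tri<; tri≈; tri>)
open import Relation.Binary.PropositionalEquality
  using (_≡_; _≢_; refl; sym; trans; cong; cong₂; subst; subst₂; ≢-sym; module ≡-Reasoning)
open import Relation.Nullary using (¬_; Dec; yes; no; does; contradiction; ¬?; _×-dec_; _⊎-dec_; _→-dec_)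
open import Relation.Nullary.Decidable using (decidable-stable)
open import Relation.Unary using (Decidable)
open import Defs hiding (sym)

open Algebra.Properties.CommutativeMonoid.Sum +-0-commutativeMonoid
  using (sum; ∑-distrib-+; ∑-comm; sum-cong-≗)

private variable
  n c s q : ℕ

-- Colour sets and deletion of colours.

infixl 5 _∖_
_∖_ : Subset c → Fin c → Subset c
p ∖ x = p [ x ]≔ outside

∣p∣≤1+∣p∖x∣ : (p : Subset c) (x : Fin c) → ∣ p ∣ ≤ suc ∣ p ∖ x ∣
∣p∣≤1+∣p∖x∣ (inside  ∷ᵛ p) zero    = ≤-refl
∣p∣≤1+∣p∖x∣ (outside ∷ᵛ p) zero    = m≤n+m _ 1
∣p∣≤1+∣p∖x∣ (inside  ∷ᵛ p) (suc x) = s≤s (∣p∣≤1+∣p∖x∣ p x)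
∣p∣≤1+∣p∖x∣ (outside ∷ᵛ p) (suc x) = ∣p∣≤1+∣p∖x∣ p x

p∖x⊆p : (p : Subset c) (x : Fin c) → p ∖ x ⊆ p
p∖x⊆p (_ ∷ᵛ p) zero    (there y∈) = there y∈
p∖x⊆p (_ ∷ᵛ p) (suc x) here       = here
p∖x⊆p (_ ∷ᵛ p) (suc x) (there y∈) = there (p∖x⊆p p x y∈)

x∉p∖x : (p : Subset c) (x : Fin c) → x ∉ p ∖ x
x∉p∖x (_ ∷ᵛ p) (suc x) (there x∈) = x∉p∖x p x x∈

x∉p⇒∣p∣≤∣p∖x∣ : {p : Subset c} {x : Fin c} → x ∉ p → ∣ p ∣ ≤ ∣ p ∖ x ∣
x∉p⇒∣p∣≤∣p∖x∣ {p = p} {x} x∉p =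
  p⊆q⇒∣p∣≤∣q∣ λ {y} y∈p → []≔-minimal p y x (λ { refl → x∉p y∈p }) y∈p

⊆⊎∃∉ : (p q : Subset c) → p ⊆ q ⊎ (∃[ x ] x ∈ p × x ∉ q)
⊆⊎∃∉ p q with any? (λ x → (x ∈? p) ×-dec ¬? (x ∈? q))
... | yes w = inj₂ w
... | no ∄x = inj₁ λ {x} x∈p → p⇒q x x∈p
  where
  p⇒q : ∀ x → x ∈ p → x ∈ q
  p⇒q x x∈p with x ∈? q
  ... | yes x∈q = x∈q
  ... | no  x∉q = contradiction (x , x∈p , x∉q) ∄x

⊆∧∣∣≤⇒≡ : {p q : Subset c} → p ⊆ q → ∣ q ∣ ≤ ∣ p ∣ → p ≡ q
⊆∧∣∣≤⇒≡ {p = p} {q} p⊆q ∣q∣≤∣p∣ with ⊆⊎∃∉ q p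
... | inj₁ q⊆p = ⊆-antisym p⊆q q⊆p
... | inj₂ x   = contradiction ∣q∣≤∣p∣ (<⇒≱ (p⊂q⇒∣p∣<∣q∣ (p⊆q , x)))

without : Subset c → List (Fin c) → Subset c
without p []       = p
without p (x ∷ xs) = without (p ∖ x) xs

∣p∣≤length+∣without∣ : (p : Subset c) (xs : List (Fin c)) → ∣ p ∣ ≤ length xs + ∣ without p xs ∣
∣p∣≤length+∣without∣ p []       = ≤-refl
∣p∣≤length+∣without∣ p (x ∷ xs) =
  ≤-trans (∣p∣≤1+∣p∖x∣ p x) (s≤s (∣p∣≤length+∣without∣ (p ∖ x) xs))

without⊆ : (p : Subset c) (xs : List (Fin c)) → without p xs ⊆ p
without⊆ p []       y∈ = y∈
without⊆ p (x ∷ xs) y∈ = p∖x⊆p p x (without⊆ (p ∖ x) xs y∈)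

∈-without⇒∉ : (p : Subset c) (xs : List (Fin c)) {y : Fin c} → y ∈ without p xs → y ∉ˡ xs
∈-without⇒∉ p (x ∷ xs) y∈ (here refl)  = x∉p∖x p x (without⊆ (p ∖ x) xs y∈)
∈-without⇒∉ p (x ∷ xs) y∈ (there y∈xs) = ∈-without⇒∉ (p ∖ x) xs y∈ y∈xs

0<∣p∣⇒Nonempty : {p : Subset c} → 0 < ∣ p ∣ → Nonempty p
0<∣p∣⇒Nonempty {c} {p} 0<∣p∣ with nonempty? p
... | yes ne = ne
... | no ¬ne = contradiction (sym (trans (cong ∣_∣ (Empty-unique ¬ne)) (∣⊥∣≡0 c))) (<⇒≢ 0<∣p∣)

-- Deleting the entries of `xs` one at a time costs at most one element of `p` each, so something
-- survives.
fresh : (p : Subset c) (xs : List (Fin c)) → length xs < ∣ p ∣ → ∃[ y ] y ∈ p × y ∉ˡ xs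
fresh p xs len< =
  let 0<∣∣ = +-cancelˡ-≤ (length xs) 1 _
               (≤-trans (≤-reflexive (+-comm (length xs) 1)) (≤-trans len< (∣p∣≤length+∣without∣ p xs)))
      y , y∈ = 0<∣p∣⇒Nonempty 0<∣∣
  in y , without⊆ p xs y∈ , ∈-without⇒∉ p xs y∈

-- Systems of distinct representatives.

Transversal : (Fin s → Subset c) → Set
Transversal M = ∃[ g ] (∀ i → g i ∈ M i) × Injective _≡_ _≡_ g

-- Colours are chosen greedily from the last index to the first. When index `i` is reached, the
-- `s - 1 - i` later indices have used one colour each, and the size condition leaves one more.
transversal : (M : Fin s → Subset c) → (∀ i → s ≤ toℕ i + ∣ M i ∣) → Transversal M
transversal {zero}  M large = (λ ()) , (λ ()) , λ { {()} }
transversal {suc s} M large with transversal (M ∘ suc) (λ i → ≤-pred (large (suc i)))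
... | g , g∈ , g-inj with fresh (M zero) (tabulate g) (≤-trans (s≤s (≤-reflexive (length-tabulate g))) (large zero))
...   | x , x∈ , x∉g = h , h∈ , h-inj
  where
  h : Fin (suc s) → _
  h zero    = x
  h (suc i) = g i

  h∈ : ∀ i → h i ∈ M i
  h∈ zero    = x∈
  h∈ (suc i) = g∈ i

  h-inj : Injective _≡_ _≡_ h
  h-inj {zero}  {zero}  _   = refl
  h-inj {zero}  {suc j} refl = contradiction (∈-tabulate⁺ j) x∉g
  h-inj {suc i} {zero}  refl = contradiction (∈-tabulate⁺ i) x∉g
  h-inj {suc i} {suc j} eq  = cong suc (g-inj eq)

-- Sums and counting by indicators.

sum-mono-≤ : {f g : Fin n → ℕ} → (∀ i → f i ≤ g i) → sum f ≤ sum g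
sum-mono-≤ {zero}  f≤g = z≤n
sum-mono-≤ {suc n} f≤g = +-mono-≤ (f≤g zero) (sum-mono-≤ (f≤g ∘ suc))

sum-mono-< : {f g : Fin n → ℕ} → (∀ i → f i ≤ g i) → ∀ j → f j < g j → sum f < sum g
sum-mono-< f≤g zero    f<g = +-mono-<-≤ f<g (sum-mono-≤ (f≤g ∘ suc))
sum-mono-< f≤g (suc j) f<g = +-mono-≤-< (f≤g zero) (sum-mono-< (f≤g ∘ suc) j f<g)

term≤sum : (f : Fin n → ℕ) → ∀ i → f i ≤ sum f
term≤sum f zero    = m≤m+n (f zero) _
term≤sum f (suc i) = ≤-trans (term≤sum (f ∘ suc) i) (m≤n+m _ (f zero))

𝟙 : {P : Set} → Dec P → ℕ
𝟙 P? = if does P? then 1 else 0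

𝟙-true : {P : Set} (P? : Dec P) → P → 𝟙 P? ≡ 1
𝟙-true (yes _) p = refl
𝟙-true (no ¬p) p = contradiction p ¬p

𝟙-≤ : {P : Set} (P? : Dec P) {k : ℕ} → (P → 1 ≤ k) → 𝟙 P? ≤ k
𝟙-≤ (yes p) 1≤k = 1≤k p
𝟙-≤ (no _)  _   = z≤n

length-filter-tabulate : {A : Set} {P : A → Set} (P? : Decidable P) (f : Fin s → A) →
                         length (filter P? (tabulate f)) ≡ sum (λ i → 𝟙 (P? (f i)))
length-filter-tabulate {zero}  P? f = refl
length-filter-tabulate {suc s} P? f with does (P? (f zero))
... | true  = cong suc (length-filter-tabulate P? (f ∘ suc))
... | false = length-filter-tabulate P? (f ∘ suc)

-- Turns `numEdges` into a double sum of indicators, where the order of summation can be exchanged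
-- for the handshake bound.
length-filter-cartesianProduct :
  {A B : Set} {P : A × B → Set} (P? : Decidable P) (f : Fin s → A) (g : Fin n → B) →
  length (filter P? (cartesianProduct (tabulate f) (tabulate g))) ≡ sum (λ i → sum (λ j → 𝟙 (P? (f i , g j))))
length-filter-cartesianProduct {zero}  P? f g = refl
length-filter-cartesianProduct {suc s} P? f g = begin
  length (filter P? (row ++ rows))                  ≡⟨ cong length (filter-++ P? row rows) ⟩
  length (filter P? row ++ filter P? rows)          ≡⟨ length-++ (filter P? row) ⟩
  length (filter P? row) + length (filter P? rows)  ≡⟨ cong₂ _+_ row≡ (length-filter-cartesianProduct P? (f ∘ suc) g) ⟩
  _                                                 ∎
  where
  open ≡-Reasoning
  row  = map (f zero ,_) (tabulate g)
  rows = cartesianProduct (tabulate (f ∘ suc)) (tabulate g)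

  row≡ : length (filter P? row) ≡ sum (λ j → 𝟙 (P? (f zero , g j)))
  row≡ = trans (cong (length ∘ filter P?) (map-tabulate g (f zero ,_)))
               (length-filter-tabulate P? (λ j → f zero , g j))

-- Greedy extension and partial colourings.

module ListColoring {n} (G : Graph n) where

  neighbours : Fin n → List (Fin n)
  neighbours v = filter (adj? G v) (allFin n)

  deg : Fin n → ℕ
  deg = length ∘ neighbours

  record JoinColoring (L : Fin n → Subset c) (M : Fin s → Subset c) : Set where
    field
      f      : Fin n → Fin c
      g      : Fin s → Fin c
      f∈     : ∀ v → f v ∈ L v
      g∈     : ∀ a → g a ∈ M a
      proper : ∀ {u v} → Adj G u v → f u ≢ f v
      g-inj  : Injective _≡_ _≡_ g
      apart  : ∀ v a → f v ≢ g a

  module _ (L : Fin n → Subset c) (g : Fin s → Fin c) where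

    -- A partial colouring is encoded as a total map whose values on `xs`, the vertices still to be
    -- coloured, are arbitrary.
    record ProperOff (xs : List (Fin n)) (f : Fin n → Fin c) : Set where
      field
        f∈     : ∀ {v} → v ∉ˡ xs → f v ∈ L v
        proper : ∀ {u v} → u ∉ˡ xs → v ∉ˡ xs → Adj G u v → f u ≢ f v
        apart  : ∀ {v} → v ∉ˡ xs → ∀ a → f v ≢ g a

    recolour : (f : Fin n → Fin c) (x : Fin n) (y : Fin c) →
               ∃[ f′ ] f′ x ≡ y × (∀ {v} → v ≢ x → f′ v ≡ f v)
    recolour f x y = updateAt f x (const y) , updateAt-updates x f , λ {v} v≢x → updateAt-minimal v x f v≢x

    -- The clique forbids `s` colours at `x` and the neighbours at most `deg x`, so a happy `x` has
    -- a colour left. The arbitrary values of `f` at neighbours still in `xs` are avoided too; the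
    -- count already includes them.
    extend₁ : ∀ {x xs f} → s + deg x < ∣ L x ∣ → ProperOff (x ∷ xs) f → ∃ (ProperOff xs)
    extend₁ {x} {xs} {f} happy P
      with fresh (L x) (tabulate g ++ map f (neighbours x)) (≤-trans (s≤s (≤-reflexive eq)) happy)
      where
      eq : length (tabulate g ++ map f (neighbours x)) ≡ s + deg x
      eq = trans (length-++ (tabulate g)) (cong₂ _+_ (length-tabulate g) (length-map f (neighbours x)))
    ... | y , y∈ , y∉ with recolour f x y
    ...   | f′ , f′x≡y , f′≡f = f′ , record { f∈ = f′∈ ; proper = f′-proper ; apart = f′-apart }
      where
      open ProperOff P

      ∉∷ : ∀ {v} → v ≢ x → v ∉ˡ xs → v ∉ˡ x ∷ xs
      ∉∷ v≢x v∉xs (here v≡x)   = v≢x v≡x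
      ∉∷ v≢x v∉xs (there v∈xs) = v∉xs v∈xs

      f′∈ : ∀ {v} → v ∉ˡ xs → f′ v ∈ L v
      f′∈ {v} v∉ with v ≟ x
      ... | yes refl rewrite f′x≡y    = y∈
      ... | no  v≢x  rewrite f′≡f v≢x = f∈ (∉∷ v≢x v∉)

      y≢f : ∀ {v} → Adj G x v → y ≢ f v
      y≢f xv refl = y∉ (∈-++⁺ʳ (tabulate g) (∈-map⁺ f (∈-filter⁺ (adj? G x) (∈-allFin _) xv)))

      f′-proper : ∀ {u v} → u ∉ˡ xs → v ∉ˡ xs → Adj G u v → f′ u ≢ f′ v
      f′-proper {u} {v} u∉ v∉ uv with u ≟ x | v ≟ x
      ... | yes refl | yes refl = contradiction uv (irrefl G x)
      ... | yes refl | no  v≢x  rewrite f′x≡y | f′≡f v≢x = y≢f uv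
      ... | no  u≢x  | yes refl rewrite f′x≡y | f′≡f u≢x = ≢-sym (y≢f (Graph.sym G uv))
      ... | no  u≢x  | no  v≢x  rewrite f′≡f u≢x | f′≡f v≢x = proper (∉∷ u≢x u∉) (∉∷ v≢x v∉) uv

      f′-apart : ∀ {v} → v ∉ˡ xs → ∀ a → f′ v ≢ g a
      f′-apart {v} v∉ a with v ≟ x
      ... | yes refl rewrite f′x≡y    = λ { refl → y∉ (∈-++⁺ˡ (∈-tabulate⁺ a)) }
      ... | no  v≢x  rewrite f′≡f v≢x = apart (∉∷ v≢x v∉) a

    extend : ∀ {xs f} → All (λ x → s + deg x < ∣ L x ∣) xs → ProperOff xs f → ∃ (ProperOff [])
    extend []              P = _ , P
    extend (happy ∷ happys) P = extend happys (proj₂ (extend₁ happy P))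

  -- Colours are assigned to vertices together with a proof of `w ≢ v`, not to all of `Fin n`, so
  -- that `q = 0` is possible when `v` is the only vertex.
  VertexDeletedColorable : ℕ → Set
  VertexDeletedColorable q =
    ∀ v → Σ[ φ ∈ (∀ w → w ≢ v → Fin q) ]
      (∀ {u w} (u≢v : u ≢ v) (w≢v : w ≢ v) → Adj G u w → φ u u≢v ≢ φ w w≢v)

  module _ (deleted : VertexDeletedColorable q) where

    abstract
      -- The palette `C` is left open because the lemma serves twice: with list colours in
      -- `complete`, and with the disjoint union of base and clique colours in the proof that the
      -- join is critical.
      paint : {C : Set} (e : Fin q → C) → Injective _≡_ _≡_ e → ∀ v x →
              Σ[ f ∈ (Fin n → C) ]
                f v ≡ x
              × (∀ {w} → w ≢ v → ∃[ i ] f w ≡ e i)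
              × (∀ {u w} → u ≢ v → w ≢ v → Adj G u w → f u ≢ f w)
      paint {C} e e-inj v x with deleted v
      ... | φ , φ-proper = f , f-centre , f-off , f-proper
        where
        f : Fin n → C
        f w with w ≟ v
        ... | yes _  = x
        ... | no w≢v = e (φ w w≢v)

        f-centre : f v ≡ x
        f-centre with v ≟ v
        ... | yes _  = refl
        ... | no v≢v = contradiction refl v≢v

        f-off : ∀ {w} → w ≢ v → ∃[ i ] f w ≡ e i
        f-off {w} w≢v with w ≟ v
        ... | yes w≡v = contradiction w≡v w≢v
        ... | no  _   = _ , refl

        f-proper : ∀ {u w} → u ≢ v → w ≢ v → Adj G u w → f u ≢ f w
        f-proper {u} {w} u≢v w≢v uw with u ≟ v | w ≟ v
        ... | yes u≡v | _        = contradiction u≡v u≢v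
        ... | no  _   | yes w≡v  = contradiction w≡v w≢v
        ... | no  u≢  | no  w≢   = φ-proper u≢ w≢ uw ∘ e-inj

  -- Happy vertices and completion of a colouring.

  module _ (L : Fin n → Subset c) (s : ℕ) where

    Happy : Fin n → Set
    Happy v = s + deg v < ∣ L v ∣

    happy? : ∀ v → Dec (Happy v)
    happy? v = s + deg v <? ∣ L v ∣

    need : Fin n → ℕ
    need v = suc (s + deg v) ∸ ∣ L v ∣

  complete : VertexDeletedColorable q → (L : Fin n → Subset c) (M : Fin s → Subset c) →
             (e : Fin q → Fin c) → Injective _≡_ _≡_ e → (∀ w → ¬ Happy L s w → ∀ i → e i ∈ L w) →
             ((g , _) : Transversal M) → (∀ i a → e i ≢ g a) →
             ∀ v x → Happy L s v ⊎ (x ∈ L v × (∀ i → x ≢ e i) × (∀ a → x ≢ g a)) →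
             JoinColoring L M
  complete {s = s} deleted L M e e-inj e∈ (g , g∈ , g-inj) e≢g v x v-ok
    with paint deleted e e-inj v x
  ... | f , f-centre , f-off , f-proper = record
    { f = proj₁ ext ; g = g
    ; f∈ = λ w → ProperOff.f∈ P λ () ; g∈ = g∈
    ; proper = ProperOff.proper P (λ ()) (λ ()) ; g-inj = g-inj
    ; apart = λ w → ProperOff.apart P λ ()
    }
    where
    xs : List (Fin n)
    xs = filter (happy? L s) (allFin n)

    unhappy : ∀ {w} → w ∉ˡ xs → ¬ Happy L s w
    unhappy w∉ happy = w∉ (∈-filter⁺ (happy? L s) (∈-allFin _) happy)

    centre-ok : v ∉ˡ xs → x ∈ L v × (∀ i → x ≢ e i) × (∀ a → x ≢ g a)
    centre-ok v∉ = fromInj₂ (λ happy → contradiction happy (unhappy v∉)) v-ok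

    centre≢off : ∀ {w} → v ∉ˡ xs → w ≢ v → x ≢ f w
    centre≢off v∉ w≢v x≡fw with f-off w≢v
    ... | i , fw≡ei = proj₁ (proj₂ (centre-ok v∉)) i (trans x≡fw fw≡ei)

    start∈ : ∀ {w} → w ∉ˡ xs → f w ∈ L w
    start∈ {w} w∉ with w ≟ v
    ... | yes refl rewrite f-centre = proj₁ (centre-ok w∉)
    ... | no w≢v with f-off w≢v
    ...   | i , fw≡ei rewrite fw≡ei = e∈ w (unhappy w∉) i

    start-proper : ∀ {u w} → u ∉ˡ xs → w ∉ˡ xs → Adj G u w → f u ≢ f w
    start-proper {u} {w} u∉ w∉ uw with u ≟ v | w ≟ v
    ... | yes refl | yes refl = contradiction uw (irrefl G v)
    ... | yes refl | no  w≢v  rewrite f-centre = centre≢off u∉ w≢v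
    ... | no  u≢v  | yes refl rewrite f-centre = ≢-sym (centre≢off w∉ u≢v)
    ... | no  u≢v  | no  w≢v  = f-proper u≢v w≢v uw

    start-apart : ∀ {w} → w ∉ˡ xs → ∀ a → f w ≢ g a
    start-apart {w} w∉ with w ≟ v
    ... | yes refl rewrite f-centre = proj₂ (proj₂ (centre-ok w∉))
    ... | no w≢v with f-off w≢v
    ...   | i , fw≡ei rewrite fw≡ei = e≢g i

    ext : ∃ (ProperOff L g [])
    ext = extend L g (all-filter (happy? L s) (allFin n))
            (record { f∈ = start∈ ; proper = start-proper ; apart = start-apart })

    P : ProperOff L g [] (proj₁ ext)
    P = proj₂ ext

  -- List colourings by induction on the clique.

  colourCliqueVertex : {L : Fin n → Subset c} {M : Fin (suc s) → Subset c} → ∀ a {x} → x ∈ M a →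
    JoinColoring (λ v → L v ∖ x) (λ b → M (punchIn a b) ∖ x) → JoinColoring L M
  colourCliqueVertex {c = c} {s = s} {L = L} {M} a {x} x∈ col = record
    { f = f ; g = g′
    ; f∈ = λ v → p∖x⊆p (L v) x (f∈ v) ; g∈ = g′∈
    ; proper = proper ; g-inj = g′-inj ; apart = f≢g′
    }
    where
    open JoinColoring col

    g′ : Fin (suc s) → Fin c
    g′ = insertAt g a x

    view : ∀ b → b ≡ a ⊎ (∃[ b′ ] b ≡ punchIn a b′)
    view b with a ≟ b
    ... | yes a≡b = inj₁ (sym a≡b)
    ... | no  a≢b = inj₂ (punchOut a≢b , sym (punchIn-punchOut a≢b))

    g′∈ : ∀ b → g′ b ∈ M b
    g′∈ b with view b
    ... | inj₁ refl rewrite insertAt-lookup g a x = x∈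
    ... | inj₂ (b′ , refl) rewrite insertAt-punchIn g a x b′ = p∖x⊆p (M _) x (g∈ b′)

    x≢g : ∀ b → x ≢ g b
    x≢g b x≡gb = x∉p∖x (M (punchIn a b)) x (subst (_∈ _) (sym x≡gb) (g∈ b))

    g′-inj : Injective _≡_ _≡_ g′
    g′-inj {b₁} {b₂} eq with view b₁ | view b₂
    ... | inj₁ refl | inj₁ refl = refl
    ... | inj₁ refl | inj₂ (b , refl) rewrite insertAt-lookup g a x | insertAt-punchIn g a x b =
      contradiction eq (x≢g b)
    ... | inj₂ (b , refl) | inj₁ refl rewrite insertAt-lookup g a x | insertAt-punchIn g a x b =
      contradiction (sym eq) (x≢g b)
    ... | inj₂ (b , refl) | inj₂ (b′ , refl) rewrite insertAt-punchIn g a x b | insertAt-punchIn g a x b′ =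
      cong (punchIn a) (g-inj eq)

    f≢g′ : ∀ v b → f v ≢ g′ b
    f≢g′ v b with view b
    ... | inj₁ refl rewrite insertAt-lookup g a x = λ fv≡x → x∉p∖x (L v) x (subst (_∈ L v ∖ x) fv≡x (f∈ v))
    ... | inj₂ (b′ , refl) rewrite insertAt-punchIn g a x b′ = apart v b′

  -- The sizes are only bounded below: deleting a colour leaves the lists that miss it unchanged, so
  -- lists become unequal in size.
  record Invariant (q s : ℕ) (L : Fin n → Subset c) (M : Fin s → Subset c) : Set where
    field
      L≥    : ∀ v → q + s ≤ ∣ L v ∣
      M≥    : ∀ a → q + s ≤ ∣ M a ∣
      need≤ : sum (need L s) ≤ s

  private
    ≤∣∖∣ : (p : Subset c) (x : Fin c) → q + suc s ≤ ∣ p ∣ → q + s ≤ ∣ p ∖ x ∣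
    ≤∣∖∣ {q = q} {s} p x q+s≤ =
      ≤-pred (≤-trans (≤-reflexive (sym (+-suc q s))) (≤-trans q+s≤ (∣p∣≤1+∣p∖x∣ p x)))

    <∣∖∣ : {p : Subset c} {x : Fin c} → x ∉ p → q + suc s ≤ ∣ p ∣ → q + s < ∣ p ∖ x ∣
    <∣∖∣ {q = q} {s} x∉ q+s≤ = ≤-trans (≤-reflexive (sym (+-suc q s))) (≤-trans q+s≤ (x∉p⇒∣p∣≤∣p∖x∣ x∉))

  -- As `s` drops by one and no list loses more than one colour, no need grows. The list of `w`
  -- keeps its size, so its need falls, being positive because `w` is unhappy. Hence the total need
  -- falls along with `s`.
  step-invariant : {L : Fin n → Subset c} {M : Fin (suc s) → Subset c} → ∀ a {x w} →
    x ∉ L w → ¬ Happy L (suc s) w →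
    Invariant q (suc s) L M → Invariant q s (λ v → L v ∖ x) (λ b → M (punchIn a b) ∖ x)
  step-invariant {s = s} {L = L} {M} a {x} {w} x∉ unhappy inv = record
    { L≥ = λ v → ≤∣∖∣ (L v) x (L≥ v)
    ; M≥ = λ b → ≤∣∖∣ (M _) x (M≥ (punchIn a b))
    ; need≤ = ≤-pred (<-≤-trans (sum-mono-< need-≤ w need-<) need≤)
    }
    where
    open Invariant inv

    need-≤ : ∀ v → need (λ v → L v ∖ x) s v ≤ need L (suc s) v
    -- The needed subtraction with `suc` added on both sides, which reduces away on the left.
    need-≤ v = ∸-monoʳ-≤ (suc (suc (s + deg v))) (∣p∣≤1+∣p∖x∣ (L v) x)

    need-< : need (λ v → L v ∖ x) s w < need L (suc s) w
    -- Unhappiness means that the subtraction is not truncated, so `suc` can be moved out of it.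
    need-< = ≤-trans (s≤s (∸-monoʳ-≤ (suc (s + deg w)) (x∉p⇒∣p∣≤∣p∖x∣ x∉)))
                     (≤-reflexive (sym (+-∸-assoc 1 (≮⇒≥ unhappy))))

  stuck : VertexDeletedColorable q → {L : Fin n → Subset c} {M : Fin (suc s) → Subset c} →
          Invariant q (suc s) L M → (∀ w → ¬ Happy L (suc s) w → M zero ⊆ L w) →
          ∀ v → Happy L (suc s) v ⊎ q + suc s < ∣ L v ∣ → JoinColoring L M
  stuck {q = q} {c = c} {s = s} deleted {L} {M} inv M₀⊆L v v-special
    with transversal {s = q} (λ _ → M zero)
           (λ i → ≤-trans (≤-trans (m≤m+n q _) (Invariant.M≥ inv zero)) (m≤n+m _ (toℕ i)))
  ... | e , e∈ , e-inj = finish v-special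
    where
    open Invariant inv

    E : List (Fin c)
    E = tabulate e

    remaining : ∀ {r} (p : Subset c) → q + r ≤ ∣ p ∣ → r ≤ ∣ without p E ∣
    remaining p q+r≤ = +-cancelˡ-≤ q _ _
      (≤-trans q+r≤ (subst (λ l → ∣ p ∣ ≤ l + ∣ without p E ∣) (length-tabulate e) (∣p∣≤length+∣without∣ p E)))

    E-in-L : ∀ w → ¬ Happy L (suc s) w → ∀ i → e i ∈ L w
    E-in-L w unhappy i = M₀⊆L w unhappy (e∈ i)

    weaken : ∀ {M′ : Fin (suc s) → Subset c} → (∀ a → M′ a ⊆ M a) → Transversal M′ → Transversal M
    weaken M′⊆M (g , g∈ , g-inj) = g , (λ a → M′⊆M a (g∈ a)) , g-inj

    with-surplus : ∀ {x} → x ∈ L v → (∀ i → x ≢ e i) → suc s ≤ ∣ without (M zero ∖ x) E ∣ → JoinColoring L M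
    with-surplus {x} x∈ x≢e enough =
      complete deleted L M e e-inj E-in-L (weaken (λ a → p∖x⊆p (M a) x ∘ without⊆ (M a ∖ x) E) T)
        (λ i a e≡g → ∈-without⇒∉ (M a ∖ x) E (proj₁ (proj₂ T) a) (subst (_∈ˡ E) e≡g (∈-tabulate⁺ i)))
        v x (inj₂ (x∈ , x≢e , λ a x≡g →
          x∉p∖x (M a) x (subst (_∈ M a ∖ x) (sym x≡g) (without⊆ (M a ∖ x) E (proj₁ (proj₂ T) a)))))
      where
      -- Only the list of the first clique vertex needs suc s colours, as it is coloured last.
      T : Transversal (λ a → without (M a ∖ x) E)
      T = transversal _ λ
        { zero    → enough
        ; (suc b) → s≤s (≤-trans (remaining (M (suc b) ∖ x) (≤∣∖∣ (M (suc b)) x (M≥ (suc b)))) (m≤n+m _ (toℕ b)))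
        }

    finish : Happy L (suc s) v ⊎ q + suc s < ∣ L v ∣ → JoinColoring L M
    finish (inj₁ happy) =
      complete deleted L M e e-inj E-in-L (weaken (λ a → without⊆ (M a) E) T)
        (λ i a e≡g → ∈-without⇒∉ (M a) E (proj₁ (proj₂ T) a) (subst (_∈ˡ E) e≡g (∈-tabulate⁺ i)))
        -- A happy `v` is recoloured anyway; the first clique colour is a default.
        v (proj₁ T zero) (inj₁ happy)
      where
      T : Transversal (λ a → without (M a) E)
      T = transversal _ λ a → ≤-trans (remaining (M a) (M≥ a)) (m≤n+m _ (toℕ a))
    -- Keeping the colour `x` of `v` off the clique leaves at least `s` colours outside `E` in each
    -- clique list, and the first list must supply one more. Either `x` is not in that list, or the
    -- list contains all of `L v` and inherits its surplus.
    finish (inj₂ surplus) with ⊆⊎∃∉ (L v) (M zero)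
    ... | inj₂ (x , x∈ , x∉M₀) =
      with-surplus x∈ (λ { i refl → x∉M₀ (e∈ i) })
        (remaining (M zero ∖ x) (≤-trans (M≥ zero) (x∉p⇒∣p∣≤∣p∖x∣ x∉M₀)))
    ... | inj₁ Lv⊆M₀ with fresh (L v) E (≤-<-trans (≤-trans (≤-reflexive (length-tabulate e)) (m≤m+n q _)) surplus)
    ...   | x , x∈ , x∉E =
      with-surplus x∈ (λ { i refl → x∉E (∈-tabulate⁺ i) })
        (remaining (M zero ∖ x)
          (≤∣∖∣ (M zero) x (≤-trans (≤-trans (≤-reflexive (+-suc q (suc s))) surplus) (p⊆q⇒∣p∣≤∣q∣ Lv⊆M₀))))

  colorable-from-surplus : VertexDeletedColorable q → ∀ s
    {L : Fin n → Subset c} {M : Fin s → Subset c} → Invariant q s L M →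
    ∀ v → Happy L s v ⊎ q + s < ∣ L v ∣ → JoinColoring L M
  colorable-from-surplus {q = q} deleted zero {L} {M} inv v _ =
    -- With every vertex happy, `e` and `x` are fillers that the greedy colouring overwrites.
    let e , e∈ , e-inj = transversal {s = q} (λ _ → L v)
                           (λ i → ≤-trans (≤-trans (m≤m+n q 0) (L≥ v)) (m≤n+m _ (toℕ i)))
        x , _ = 0<∣p∣⇒Nonempty {p = L v} (≤-<-trans z≤n (all-happy v))
    in complete deleted L M e e-inj (λ w unhappy → contradiction (all-happy w) unhappy)
         ((λ ()) , (λ ()) , λ { {()} }) (λ _ ()) v x (inj₁ (all-happy v))
    where
    open Invariant inv
    all-happy : ∀ w → Happy L zero w
    all-happy w = m∸n≡0⇒m≤n (n≤0⇒n≡0 (≤-trans (term≤sum (need L zero) w) need≤))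
  colorable-from-surplus {q = q} deleted (suc s) {L} {M} inv v v-special
    with any? (λ w → ¬? (happy? L (suc s) w) ×-dec any? (λ x → (x ∈? M zero) ×-dec ¬? (x ∈? L w)))
  -- While `s` drops, the list of `w` loses nothing, so `w` has a surplus and is the special vertex
  -- of the next round.
  ... | yes (w , unhappy , x , x∈ , x∉) =
    colourCliqueVertex zero x∈
      (colorable-from-surplus deleted s (step-invariant zero x∉ unhappy inv) w (inj₂ (<∣∖∣ x∉ (Invariant.L≥ inv w))))
  ... | no ∄wx = stuck deleted inv M₀⊆L v v-special
    where
    M₀⊆L : ∀ w → ¬ Happy L (suc s) w → M zero ⊆ L w
    M₀⊆L w unhappy with ⊆⊎∃∉ (M zero) (L w)
    ... | inj₁ M₀⊆Lw = M₀⊆Lw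
    ... | inj₂ x     = contradiction (w , unhappy , x) ∄wx

  -- If `v` is happy it is already special. Otherwise giving `x` to `a` lowers `s` without shrinking
  -- the list of `v`, which creates the surplus that starts the induction.
  colorable-from-difference : VertexDeletedColorable q →
    {L : Fin n → Subset c} {M : Fin s → Subset c} → Invariant q s L M →
    ∀ a v {x} → x ∈ M a → x ∉ L v → JoinColoring L M
  colorable-from-difference {s = suc s} deleted {L} inv a v x∈ x∉ with happy? L (suc s) v
  ... | yes happy  = colorable-from-surplus deleted (suc s) inv v (inj₁ happy)
  ... | no unhappy =
    colourCliqueVertex a x∈
      (colorable-from-surplus deleted s (step-invariant a x∉ unhappy inv) v (inj₂ (<∣∖∣ x∉ (Invariant.L≥ inv v))))

  -- The handshake bound.

  sum-deg≤ : sum deg ≤ numEdges G + numEdges G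
  sum-deg≤ = begin
    sum deg                                        ≡⟨ sum-cong-≗ (λ v → length-filter-tabulate (adj? G v) (λ u → u)) ⟩
    sum (λ v → sum (λ u → 𝟙 (adj? G v u)))         ≤⟨ sum-mono-≤ (λ v → sum-mono-≤ (split v)) ⟩
    sum (λ v → sum (λ u → E v u + E u v))          ≡⟨ sum-cong-≗ (λ v → ∑-distrib-+ (E v) (λ u → E u v)) ⟩
    sum (λ v → sum (E v) + sum (λ u → E u v))      ≡⟨ ∑-distrib-+ (λ v → sum (E v)) (λ v → sum (λ u → E u v)) ⟩
    sum (λ v → sum (E v)) + sum (λ v → sum (λ u → E u v))
                                                   ≡⟨ cong (sum (λ v → sum (E v)) +_) (∑-comm (λ v u → E u v)) ⟩
    sum (λ v → sum (E v)) + sum (λ v → sum (E v))  ≡⟨ cong₂ _+_ E≡ E≡ ⟨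
    numEdges G + numEdges G                        ∎
    where
    open ≤-Reasoning

    edge? : ∀ v u → Dec (v <ᶠ u × Adj G v u)
    edge? v u = (v <ᶠ? u) ×-dec adj? G v u

    E : Fin n → Fin n → ℕ
    E v u = 𝟙 (edge? v u)

    E≡ : numEdges G ≡ sum (λ v → sum (E v))
    E≡ = length-filter-cartesianProduct (λ (v , u) → edge? v u) (λ v → v) (λ u → u)

    -- By trichotomy, an adjacent ordered pair or its reverse is a listed edge.
    split : ∀ v u → 𝟙 (adj? G v u) ≤ E v u + E u v
    split v u = 𝟙-≤ (adj? G v u) λ vu → covered vu (<-cmp v u)
      where
      covered : Adj G v u → Tri (v <ᶠ u) (v ≡ u) (u <ᶠ v) → 1 ≤ E v u + E u v
      covered vu (tri< v<u _ _)  = ≤-trans (≤-reflexive (sym (𝟙-true (edge? v u) (v<u , vu)))) (m≤m+n _ _)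
      covered vu (tri≈ _ refl _) = contradiction vu (irrefl G v)
      covered vu (tri> _ _ u<v)  =
        ≤-trans (≤-reflexive (sym (𝟙-true (edge? u v) (u<v , Graph.sym G vu)))) (m≤n+m _ (E v u))

-- Chromatic numbers.

Colorable-mono : (G : Graph n) → ∀ {i j} → i ≤ j → Colorable G i → Colorable G j
Colorable-mono G i≤j (f , f-proper) =
  (λ v → inject≤ (f v) i≤j) , λ uv → f-proper uv ∘ inject≤-injective i≤j i≤j _ _

Proper? : (G : Graph n) → ∀ {j} (f : Fin n → Fin j) → Dec (∀ u v → Adj G u v → f u ≢ f v)
Proper? G f = all? λ u → all? λ v → adj? G u v →-dec ¬? (f u ≟ f v)

Colorable? : (G : Graph n) → ∀ j → Dec (Colorable G j)
Colorable? {n} G j with any? {j ^ n} (λ i → Proper? G (finToFun i))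
... | yes (i , proper) = yes (finToFun i , proper _ _)
... | no ∄i = no λ (f , f-proper) → ∄i (funToFin f , λ u v uv eq →
        f-proper uv (trans (sym (finToFun-funToFin f u)) (trans eq (finToFun-funToFin f v))))

-- Descends from `j` as long as one colour fewer suffices. It is needed because `χ[_]<_` asks for
-- the exact chromatic number, not just for a colouring.
χ-exists : (G : Graph n) → ∀ j → Colorable G j → ∃[ i ] (χ[ G ]≡ i) × i ≤ j
χ-exists G zero    col = zero , (col , λ _ _ → z≤n) , z≤n
χ-exists G (suc j) col with Colorable? G j
... | yes col′ = let i , χ≡i , i≤j = χ-exists G j col′ in i , χ≡i , ≤-trans i≤j (m≤n+m j 1)
... | no ¬col  = suc j , (col , λ i coli → ≰⇒> λ i≤j → ¬col (Colorable-mono G i≤j coli)) , ≤-refl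

χ<⇒Colorable : (G : Graph n) → χ[ G ]< suc q → Colorable G q
χ<⇒Colorable G (j , (col , _) , s≤s j≤q) = Colorable-mono G j≤q col

Colorable⇒χ< : (G : Graph n) → Colorable G q → χ[ G ]< suc q
Colorable⇒χ< G col = let i , χ≡i , i≤q = χ-exists G _ col in i , χ≡i , s≤s i≤q

-- Vertex and edge deletion in critical graphs.

deleteVertex : Graph (suc n) → Fin (suc n) → Graph n
deleteVertex G v = record
  { Adj    = λ x y → Adj G (punchIn v x) (punchIn v y)
  ; adj?   = λ x y → adj? G (punchIn v x) (punchIn v y)
  ; sym    = Graph.sym G
  ; irrefl = λ x → irrefl G (punchIn v x)
  }

-- Equality of the unordered pairs of `x`, `y` and of `u`, `v`.
Ends : {A : Set} → A → A → A → A → Set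
Ends u v x y = (x ≡ u × y ≡ v) ⊎ (x ≡ v × y ≡ u)

Ends-sym : {A : Set} {u v x y : A} → Ends u v x y → Ends u v y x
Ends-sym (inj₁ (x≡u , y≡v)) = inj₂ (y≡v , x≡u)
Ends-sym (inj₂ (x≡v , y≡u)) = inj₁ (y≡u , x≡v)

ends? : ∀ (u v x y : Fin n) → Dec (Ends u v x y)
ends? u v x y = (x ≟ u ×-dec y ≟ v) ⊎-dec (x ≟ v ×-dec y ≟ u)

deleteEdge : Graph n → Fin n → Fin n → Graph n
deleteEdge G u v = record
  { Adj    = λ x y → Adj G x y × ¬ Ends u v x y
  ; adj?   = λ x y → adj? G x y ×-dec ¬? (ends? u v x y)
  ; sym    = λ (xy , ¬e) → Graph.sym G xy , ¬e ∘ Ends-sym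
  ; irrefl = λ x (xx , _) → irrefl G x xx
  }

EdgeDeletedColorable : Graph n → ℕ → Set
EdgeDeletedColorable {n} G q =
  ∀ u v → Adj G u v → Σ[ ψ ∈ (Fin n → Fin q) ] (∀ {x y} → Adj G x y → ψ x ≡ ψ y → Ends u v x y)

edge-deleted-colorable : (G : Graph n) → IsCritical (suc q) G → EdgeDeletedColorable G q
edge-deleted-colorable G crit u v uv =
  proj₁ col , λ {x} {y} xy eq → decidable-stable (ends? u v x y) λ ¬e → proj₂ col (xy , ¬e) eq
  where
  col : Colorable (deleteEdge G u v) _
  col = χ<⇒Colorable (deleteEdge G u v) (proj₂ (proj₂ crit) (deleteEdge G u v)
          (record { ι = λ x → x ; ι-injective = λ eq → eq ; ι-edge = proj₁ })
          (inj₂ (u , v , uv , λ (_ , ¬e) → ¬e (inj₁ (refl , refl)))))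

vertex-deleted-colorable : (G : Graph n) → IsCritical (suc q) G → ListColoring.VertexDeletedColorable G q
vertex-deleted-colorable {suc n} G crit v =
  (λ w w≢v → proj₁ col (punchOut (≢-sym w≢v))) , λ u≢v w≢v uw →
    proj₂ col (subst₂ (Adj G) (sym (punchIn-punchOut (≢-sym u≢v))) (sym (punchIn-punchOut (≢-sym w≢v))) uw)
  where
  col : Colorable (deleteVertex G v) _
  col = χ<⇒Colorable (deleteVertex G v) (proj₂ (proj₂ crit) (deleteVertex G v)
          (record { ι = punchIn v ; ι-injective = punchIn-injective v _ _ ; ι-edge = λ xy → xy })
          (inj₁ (v , λ x → punchInᵢ≢i v x)))

-- Without vertices, the empty map would be a colouring with no colours.
some-vertex : (G : Graph n) → IsCritical (suc q) G → Fin n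
some-vertex {zero}  G (_ , (_ , minimal) , _) = contradiction (minimal 0 ((λ ()) , λ { {()} })) λ ()
some-vertex {suc n} G _                       = zero

-- Indices of the join and the initial bound on the total need.

join-injective : ∀ m n {x y : Fin m ⊎ Fin n} → join m n x ≡ join m n y → x ≡ y
join-injective m n {x} {y} eq = trans (sym (splitAt-join m n x)) (trans (cong (splitAt m) eq) (splitAt-join m n y))

splitAt-injective : ∀ m {n} {x y : Fin (m + n)} → splitAt m x ≡ splitAt m y → x ≡ y
splitAt-injective m {n} {x} {y} eq =
  trans (sym (join-splitAt m n x)) (trans (cong (join m n) eq) (join-splitAt m n y))

edgeless : (G : Graph n) → numEdges G ≡ 0 → ∀ {u v} → ¬ Adj G u v
edgeless G m≡0 {u} uv = contradiction
  (<-≤-trans (∈-length (∈-filter⁺ (adj? G u) (∈-allFin _) uv))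
    (≤-trans (term≤sum deg u) (≤-trans sum-deg≤ (≤-reflexive (cong₂ _+_ m≡0 m≡0)))))
  n≮0
  where open ListColoring G

sum-need≤ : (G : Graph n) → ∀ q {t} → 1 ≤ t → 3 * numEdges G ≤ t → ListColoring.VertexDeletedColorable G q →
            (L : Fin n → Subset c) → IsAssignment (q + t) L → sum (ListColoring.need G L t) ≤ t
sum-need≤ {zero} G zero 1≤t _ _ L _ = z≤n
sum-need≤ {suc zero} G zero {t} 1≤t _ _ L L-size = ≤-trans (≤-reflexive need≡1) 1≤t
  where
  open ListColoring G

  deg≡0 : deg zero ≡ 0
  deg≡0 with adj? G zero zero
  ... | yes self = contradiction self (irrefl G zero)
  ... | no  _    = refl

  need≡1 : need L t zero + 0 ≡ 1
  need≡1 rewrite deg≡0 | L-size zero | +-identityʳ t | +-comm 1 t = trans (+-identityʳ _) (m+n∸m≡n t 1)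
-- A second vertex would have to receive a colour from `Fin 0`.
sum-need≤ {suc (suc n)} G zero _ _ deleted L _ with () ← proj₁ (deleted zero) (suc zero) (λ ())
sum-need≤ G (suc q) {t} _ 3m≤t _ L L-size = begin
  sum (need L t)           ≤⟨ sum-mono-≤ need≤deg ⟩
  sum deg                  ≤⟨ sum-deg≤ ⟩
  numEdges G + numEdges G  ≤⟨ +-monoʳ-≤ (numEdges G) (m≤m+n _ _) ⟩
  3 * numEdges G           ≤⟨ 3m≤t ⟩
  t                        ∎
  where
  open ListColoring G
  open ≤-Reasoning

  need≤deg : ∀ v → need L t v ≤ deg v
  need≤deg v rewrite L-size v =
    ≤-trans (∸-monoʳ-≤ (t + deg v) (m≤n+m t q)) (≤-reflexive (m+n∸m≡n t (deg v)))

-- The chromatic number of the join.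

module JoinComplete {n} (G : Graph n) (t : ℕ) where

  J : Graph (n + t)
  J = G ∨ K t

  Edge : Fin n ⊎ Fin t → Fin n ⊎ Fin t → Set
  Edge = JoinAdj G (K t)

  toJ : ∀ {x y} → Edge x y → Adj J (join n t x) (join n t y)
  toJ {x} {y} = subst₂ Edge (sym (splitAt-join n t x)) (sym (splitAt-join n t y))

  Colorable-join : ∀ {k} → Colorable G k → Colorable J (k + t)
  Colorable-join {k} (f , f-proper) = (λ w → join k t (h (splitAt n w))) , λ {u} {v} uv →
      h-proper (splitAt n u) (splitAt n v) uv ∘ join-injective k t
    where
    h : Fin n ⊎ Fin t → Fin k ⊎ Fin t
    h (inj₁ v) = inj₁ (f v)
    h (inj₂ a) = inj₂ a

    h-proper : ∀ x y → Edge x y → h x ≢ h y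
    h-proper (inj₁ u) (inj₁ v) uv = f-proper uv ∘ inj₁-injective
    h-proper (inj₁ u) (inj₂ b) _ ()
    h-proper (inj₂ a) (inj₁ v) _ ()
    h-proper (inj₂ a) (inj₂ b) a≢b = a≢b ∘ inj₂-injective

  -- The colours of the clique are unavailable on G; they are removed one by one.
  remove-clique-colours : ∀ s j (f : Fin n → Fin j) → IsProperColoring G f →
                          (g : Fin s → Fin j) → Injective _≡_ _≡_ g → (∀ v a → g a ≢ f v) →
                          ∃[ i ] Colorable G i × i + s ≡ j
  remove-clique-colours zero j f f-proper g _ _ = j , (f , f-proper) , +-identityʳ j
  remove-clique-colours (suc s) zero    f f-proper g _ _ with () ← g zero
  remove-clique-colours (suc s) (suc j) f f-proper g g-inj apart
    with remove-clique-colours s j (λ v → punchOut (apart v zero))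
           (λ {u} {v} uv → f-proper uv ∘ punchOut-injective (apart u zero) (apart v zero))
           (λ a → punchOut (g₀≢g a)) (λ {a} {b} → suc-injective ∘ g-inj ∘ punchOut-injective (g₀≢g a) (g₀≢g b))
           (λ v a → apart v (suc a) ∘ punchOut-injective (g₀≢g a) (apart v zero))
    where
    g₀≢g : ∀ a → g zero ≢ g (suc a)
    g₀≢g a eq with () ← g-inj eq
  ... | i , col , i+s≡j = i , col , trans (+-suc i s) (cong suc i+s≡j)

  -- The clique uses `t` distinct colours, none of which occurs on `G`, so `G` is coloured by the
  -- other `j - t`.
  Colorable-join⁻ : ∀ {k} → (∀ i → Colorable G i → k ≤ i) → ∀ j → Colorable J j → k + t ≤ j
  Colorable-join⁻ minimal j (h , h-proper)
    with remove-clique-colours t j (λ v → h (v ↑ˡ t)) (λ {u} {v} uv → h-proper (toJ {inj₁ u} {inj₁ v} uv))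
           (λ a → h (n ↑ʳ a))
           (λ {a} {b} eq → decidable-stable (a ≟ b) λ a≢b → h-proper (toJ {inj₂ a} {inj₂ b} a≢b) eq)
           (λ v a → h-proper (toJ {inj₂ a} {inj₁ v} tt))
  ... | i , col , refl = +-monoˡ-≤ t (minimal i col)

  χ-join : ∀ {k} → χ[ G ]≡ k → χ[ J ]≡ (k + t)
  χ-join (col , minimal) = Colorable-join col , Colorable-join⁻ minimal

  -- Criticality of the join.

  module _ (crit : IsCritical (suc q) G) where

    -- A colouring of the join minus one edge, with one colour fewer than its chromatic number: `q`
    -- colours meant for `G` and `t` for the clique.
    AlmostColouring : Fin n ⊎ Fin t → Fin n ⊎ Fin t → Set
    AlmostColouring x₀ y₀ =
      Σ[ h ∈ (Fin n ⊎ Fin t → Fin q ⊎ Fin t) ] (∀ {x y} → Edge x y → h x ≡ h y → Ends x₀ y₀ x y)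

    -- The vertex v leaves the q colours of G - v and takes the clique colour x.
    module _ (v : Fin n) (x : Fin t) (σ : Fin t → Fin t) where

      private
        painted = ListColoring.paint G (vertex-deleted-colorable G crit) inj₁ inj₁-injective v (inj₂ x)
        f        = proj₁ painted
        f-centre = proj₁ (proj₂ painted)
        f-off    = proj₁ (proj₂ (proj₂ painted))
        f-proper = proj₂ (proj₂ (proj₂ painted))

      shifted : Fin n ⊎ Fin t → Fin q ⊎ Fin t
      shifted (inj₁ u) = f u
      shifted (inj₂ a) = inj₂ (σ a)

      shifted-centre≢off : ∀ {u} → u ≢ v → f v ≢ f u
      shifted-centre≢off u≢v eq with f-off u≢v
      ... | i , fu≡i with () ← trans (sym f-centre) (trans eq fu≡i)

      shifted-proper : ∀ {u w} → Adj G u w → f u ≢ f w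
      shifted-proper {u} {w} uw with u ≟ v | w ≟ v
      ... | yes refl | yes refl = contradiction uw (irrefl G v)
      ... | yes refl | no  w≢v  = shifted-centre≢off w≢v
      ... | no  u≢v  | yes refl = ≢-sym (shifted-centre≢off u≢v)
      ... | no  u≢v  | no  w≢v  = f-proper u≢v w≢v uw

      shifted-conflict : ∀ u a → f u ≡ inj₂ (σ a) → u ≡ v × x ≡ σ a
      shifted-conflict u a eq with u ≟ v
      ... | yes refl = refl , inj₂-injective (trans (sym f-centre) eq)
      ... | no u≢v with f-off u≢v
      ...   | i , fu≡i with () ← trans (sym fu≡i) eq

    -- With `σ` the identity, `v` repeats the colour of `b` and of no other vertex.
    almost-cross : ∀ v b → AlmostColouring (inj₁ v) (inj₂ b)
    almost-cross v b = shifted v b (λ a → a) , λ {x} {y} → conflict x y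
      where
      conflict : ∀ x y → Edge x y → shifted v b (λ a → a) x ≡ shifted v b (λ a → a) y → Ends (inj₁ v) (inj₂ b) x y
      conflict (inj₁ u) (inj₁ w) uw eq = contradiction eq (shifted-proper v b (λ a → a) uw)
      conflict (inj₁ u) (inj₂ a) _ eq with refl , refl ← shifted-conflict v b (λ a → a) u a eq = inj₁ (refl , refl)
      conflict (inj₂ a) (inj₁ w) _ eq with refl , refl ← shifted-conflict v b (λ a → a) w a (sym eq) = inj₂ (refl , refl)
      conflict (inj₂ a) (inj₂ a′) a≢a′ eq = contradiction (inj₂-injective eq) a≢a′

    -- b′ shares the colour of b, and the colour of b′ becomes available for a vertex of G.
    almost-clique : ∀ b b′ → b ≢ b′ → AlmostColouring (inj₂ b) (inj₂ b′)
    almost-clique b b′ b≢b′ = shifted v b′ σ , λ {x} {y} → conflict x y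
      where
      v : Fin n
      v = some-vertex G crit

      σ : Fin t → Fin t
      σ a with a ≟ b′
      ... | yes _ = b
      ... | no  _ = a

      b′≢σ : ∀ a → b′ ≢ σ a
      b′≢σ a with a ≟ b′
      ... | yes _    = ≢-sym b≢b′
      ... | no  a≢b′ = ≢-sym a≢b′

      σ-conflict : ∀ a a′ → a ≢ a′ → σ a ≡ σ a′ → Ends (inj₂ b) (inj₂ b′) (inj₂ a) (inj₂ a′)
      σ-conflict a a′ a≢a′ eq with a ≟ b′ | a′ ≟ b′
      ... | yes refl | yes refl = contradiction refl a≢a′
      ... | yes refl | no _     = inj₂ (refl , cong inj₂ (sym eq))
      ... | no _     | yes refl = inj₁ (cong inj₂ eq , refl)
      ... | no _     | no _     = contradiction eq a≢a′

      conflict : ∀ x y → Edge x y → shifted v b′ σ x ≡ shifted v b′ σ y → Ends (inj₂ b) (inj₂ b′) x y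
      conflict (inj₁ u) (inj₁ w) uw eq = contradiction eq (shifted-proper v b′ σ uw)
      conflict (inj₁ u) (inj₂ a) _ eq = contradiction (proj₂ (shifted-conflict v b′ σ u a eq)) (b′≢σ a)
      conflict (inj₂ a) (inj₁ w) _ eq = contradiction (proj₂ (shifted-conflict v b′ σ w a (sym eq))) (b′≢σ a)
      conflict (inj₂ a) (inj₂ a′) a≢a′ eq = σ-conflict a a′ a≢a′ (inj₂-injective eq)

    almost-base : ∀ u v → Adj G u v → AlmostColouring (inj₁ u) (inj₁ v)
    almost-base u v uv with edge-deleted-colorable G crit u v uv
    ... | ψ , ψ-conflict = h , λ {x} {y} → conflict x y
      where
      h : Fin n ⊎ Fin t → Fin q ⊎ Fin t
      h (inj₁ w) = inj₁ (ψ w)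
      h (inj₂ a) = inj₂ a

      conflict : ∀ x y → Edge x y → h x ≡ h y → Ends (inj₁ u) (inj₁ v) x y
      conflict (inj₁ x) (inj₁ y) xy eq with ψ-conflict xy (inj₁-injective eq)
      ... | inj₁ (refl , refl) = inj₁ (refl , refl)
      ... | inj₂ (refl , refl) = inj₂ (refl , refl)
      conflict (inj₂ a) (inj₂ b) a≢b eq = contradiction (inj₂-injective eq) a≢b

    almost : ∀ x₀ y₀ → Edge x₀ y₀ → AlmostColouring x₀ y₀
    almost (inj₁ u) (inj₁ v) uv    = almost-base u v uv
    almost (inj₁ v) (inj₂ b) _     = almost-cross v b
    almost (inj₂ b) (inj₁ v) _     =
      let h , conflict = almost-cross v b in h , λ xy eq → swap (conflict xy eq)
    almost (inj₂ b) (inj₂ b′) b≢b′ = almost-clique b b′ b≢b′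

    colouring-off : ∀ x₀ → Σ[ h ∈ (∀ x → x ≢ x₀ → Fin q ⊎ Fin t) ]
                             (∀ {x y} (x≢ : x ≢ x₀) (y≢ : y ≢ x₀) → Edge x y → h x x≢ ≢ h y y≢)
    colouring-off (inj₁ v) with vertex-deleted-colorable G crit v
    ... | φ , φ-proper = h , λ {x} {y} → h-proper {x} {y}
      where
      h : ∀ x → x ≢ inj₁ v → Fin q ⊎ Fin t
      h (inj₁ w) w≢v = inj₁ (φ w (w≢v ∘ cong inj₁))
      h (inj₂ a) _   = inj₂ a

      h-proper : ∀ {x y} (x≢ : x ≢ inj₁ v) (y≢ : y ≢ inj₁ v) → Edge x y → h x x≢ ≢ h y y≢
      h-proper {inj₁ u} {inj₁ w} u≢ w≢ uw = φ-proper (u≢ ∘ cong inj₁) (w≢ ∘ cong inj₁) uw ∘ inj₁-injective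
      h-proper {inj₁ u} {inj₂ b} _ _ _ ()
      h-proper {inj₂ a} {inj₁ w} _ _ _ ()
      h-proper {inj₂ a} {inj₂ b} _ _ a≢b = a≢b ∘ inj₂-injective
    -- A vertex of `G` takes over the colour of `b`; the only conflict is with `b` itself, which is
    -- deleted.
    colouring-off (inj₂ b) with almost-cross (some-vertex G crit) b
    ... | h , conflict = (λ x _ → h x) , λ x≢ y≢ xy eq → off x≢ y≢ (conflict xy eq)
      where
      off : ∀ {x y} → x ≢ inj₂ b → y ≢ inj₂ b → ¬ Ends (inj₁ _) (inj₂ b) x y
      off x≢ y≢ (inj₁ (_ , y≡b)) = y≢ y≡b
      off x≢ y≢ (inj₂ (x≡b , _)) = x≢ x≡b

    subgraph-colorable : ∀ {n′} (G′ : Graph n′) (s : G′ ⊑ J) → Proper s → Colorable G′ (q + t)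
    subgraph-colorable G′ s (inj₁ (x₀ , omitted)) with colouring-off (splitAt n x₀)
    ... | h , h-proper =
      (λ u → join q t (h (splitAt n (ι s u)) (omitted u ∘ splitAt-injective n))) ,
      λ uv → h-proper _ _ (ι-edge s uv) ∘ join-injective q t
    subgraph-colorable G′ s (inj₂ (u₀ , v₀ , uv₀ , ¬uv₀)) with almost (splitAt n (ι s u₀)) (splitAt n (ι s v₀)) uv₀
    ... | h , conflict =
      (λ u → join q t (h (splitAt n (ι s u)))) ,
      -- A monochromatic edge of `G′` would map onto the exceptional edge, hence by injectivity be
      -- the pair that `G′` leaves non-adjacent.
      λ uv eq → not-ends uv (conflict (ι-edge s uv) (join-injective q t eq))
      where
      back : ∀ {u v} → splitAt n (ι s u) ≡ splitAt n (ι s v) → u ≡ v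
      back = ι-injective s ∘ splitAt-injective n

      not-ends : ∀ {u v} → Adj G′ u v →
                 ¬ Ends (splitAt n (ι s u₀)) (splitAt n (ι s v₀)) (splitAt n (ι s u)) (splitAt n (ι s v))
      not-ends uv (inj₁ (u≡ , v≡)) with refl ← back u≡ | refl ← back v≡ = ¬uv₀ uv
      not-ends uv (inj₂ (u≡ , v≡)) with refl ← back u≡ | refl ← back v≡ = ¬uv₀ (Graph.sym G′ uv)

    critical-join : IsCritical (suc q + t) J
    critical-join = s≤s z≤n , χ-join (proj₁ (proj₂ crit)) , λ G′ s proper →
      Colorable⇒χ< G′ (subgraph-colorable G′ s proper)

    -- Bad list assignments of the join.

    module _ (3m≤t : 3 * numEdges G ≤ t) {c} (L : ListAssignment (n + t) c) (L-size : IsAssignment (q + t) L) where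
      open ListColoring G

      baseLists : Fin n → Subset c
      baseLists v = L (v ↑ˡ t)

      cliqueLists : Fin t → Subset c
      cliqueLists a = L (n ↑ʳ a)

      fromJoinColoring : JoinColoring baseLists cliqueLists → ListColorable J L
      fromJoinColoring col =
          (λ w → h (splitAt n w))
        , (λ w → subst (λ w′ → h (splitAt n w) ∈ L w′) (join-splitAt n t w) (h∈ (splitAt n w)))
        , λ {u} {v} → h-proper (splitAt n u) (splitAt n v)
        where
        open JoinColoring col

        h : Fin n ⊎ Fin t → Fin c
        h (inj₁ v) = f v
        h (inj₂ a) = g a

        h∈ : ∀ x → h x ∈ L (join n t x)
        h∈ (inj₁ v) = f∈ v
        h∈ (inj₂ a) = g∈ a

        h-proper : ∀ x y → Edge x y → h x ≢ h y
        h-proper (inj₁ u) (inj₁ v) uv  = proper uv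
        h-proper (inj₁ u) (inj₂ b) _   = apart u b
        h-proper (inj₂ a) (inj₁ v) _   = ≢-sym (apart v a)
        h-proper (inj₂ a) (inj₂ b) a≢b = a≢b ∘ g-inj

      -- Since the two lists have equal size, they can differ only if the clique list has a colour
      -- missing from the other, and then the join is colourable.
      baseLists≡cliqueLists : Bad J L → ∀ a v → cliqueLists a ≡ baseLists v
      baseLists≡cliqueLists bad a v with ⊆⊎∃∉ (cliqueLists a) (baseLists v)
      ... | inj₁ M⊆L = ⊆∧∣∣≤⇒≡ M⊆L (≤-reflexive (trans (L-size _) (sym (L-size _))))
      ... | inj₂ (x , x∈ , x∉) = contradiction (fromJoinColoring (colorable-from-difference deleted inv a v x∈ x∉)) bad
        where
        deleted : VertexDeletedColorable q
        deleted = vertex-deleted-colorable G crit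

        inv : Invariant q t baseLists cliqueLists
        inv = record
          { L≥    = λ v → ≤-reflexive (sym (L-size _))
          ; M≥    = λ a → ≤-reflexive (sym (L-size _))
          -- The clique vertex `a` witnesses `1 ≤ t`, which covers the need in the case `q = 0`.
          ; need≤ = sum-need≤ G q (≤-trans (s≤s z≤n) (toℕ<n a)) 3m≤t deleted baseLists (λ v → L-size _)
          }

      base-and-clique-constant : ∀ S → (∀ v → baseLists v ≡ S) → (∀ a → cliqueLists a ≡ S) → IsConstant L
      base-and-clique-constant S base clique = S , λ w → trans (cong L (sym (join-splitAt n t w))) (go (splitAt n w))
        where
        go : ∀ x → L (join n t x) ≡ S
        go (inj₁ v) = base v
        go (inj₂ a) = clique a

-- For `t = 0` there are no edges, so one colour suffices for `G`, `q = 0` and all lists are empty.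
-- For positive `t`, each clique list equals each base list, and both kinds exist.
bad-constant : ∀ t (G : Graph n) → IsCritical (suc q) G → 3 * numEdges G ≤ t →
               (L : ListAssignment (n + t) c) → IsAssignment (q + t) L → Bad (G ∨ K t) L → IsConstant L
bad-constant {q = q} zero G crit 3m≤0 L L-size _ =
  ⊥ , λ w → sym (⊆∧∣∣≤⇒≡ (λ {x} → ⊆-min (L w) {x}) (≤-trans (≤-reflexive (trans (L-size w) size≡0)) z≤n))
  where
  m≡0 : numEdges G ≡ 0
  m≡0 = n≤0⇒n≡0 (≤-trans (m≤m+n _ _) 3m≤0)

  size≡0 : q + 0 ≡ 0
  size≡0 = trans (+-identityʳ q) (n≤0⇒n≡0 (≤-pred
    (proj₂ (proj₁ (proj₂ crit)) 1 ((λ _ → zero) , λ uv → contradiction uv (edgeless G m≡0)))))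
bad-constant (suc t) G crit 3m≤t L L-size bad =
  -- The common list is that of the first clique vertex; the other clique lists are compared with it
  -- through `v₀`.
  base-and-clique-constant crit 3m≤t L L-size _ (λ v → sym (same zero v))
    (λ a → trans (same a v₀) (sym (same zero v₀)))
  where
  open JoinComplete G (suc t)
  v₀ = some-vertex G crit
  same = baseLists≡cliqueLists crit 3m≤t L L-size bad

theorem1p4 : ∀ {n} (G : Graph n) → Critical G → ∀ (t : ℕ) → 3 * numEdges G ≤ t → StronglyCritical (G ∨ K t)
theorem1p4 G (zero  , () , _)
theorem1p4 G (suc q , crit) t 3m≤t =
  suc q + t , JoinComplete.critical-join G t crit , bad-constant t G crit 3m≤t
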